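{- Let $(\mathcal{R},\oplus,\leqslant)$ be a lattice ordered monoid with neutral element $0$ whose lattice is conditionally complete, let $D=(V,A)$ be a finite digraph, $d\in V$, and $(x_a)_{a\in A}\in\mathcal{R}^A$. Let $b_v^n$, $b_v^\infty$, $b_v^\dagger$ and $b_v^{\mathrm{opt}}$ be the elements of $\mathcal{R}\cup\{ -\infty,+\infty\}$ defined in the context. Suppose that $x_C\geqslant 0$ for each cycle $C$ in $D$. Then for each vertex $v$ and each $v$-$d$ path $P$, denoting by $\ell^*$ the length (number of arcs) of the longest elementary $v$-$d$ path, $$b_v^\dagger\leqslant b_v^\infty\leqslant b_v^{\ell^*}\leqslant b_v^{\mathrm{opt}}\leqslant x_P .$$ If moreover $\oplus$ distributes with respect to the meet $\wedge$, then the first three inequalities are equalities.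
   Context: A lattice ordered monoid $(\mathcal{R},\oplus,\leqslant)$ is a monoid $(\mathcal{R},\oplus)$ (associative, with neutral element $0$, possibly non-commutative) with a partial order $\leqslant$ that is a lattice order and is such that all translations $y\mapsto x\oplus y$ and $y\mapsto y\oplus x$ are isotone. Conditionally complete: every nonempty bounded subset has a meet and a join. $\mathcal{R}$ is completed into the complete lattice $\mathcal{R}\cup\{ -\infty,+\infty\}$, with $-\infty$ (resp. $+\infty$) smaller (resp. greater) than every element of $\mathcal{R}$, and $x\oplus(\pm\infty)=\pm\infty$ for $x\in\mathcal{R}$. $\wedge$ denotes the meet; the meet of the empty set is $+\infty$. $\oplus$ distributes with respect to $\wedge$ if $a\oplus(b\wedge c)=(a\oplus b)\wedge(a\oplus c)$ and $(a\wedge b)\oplus c=(a\oplus c)\wedge(b\oplus c)$ for all $a,b,c\in\mathcal{R}$. Paths are finite sequences of arcs, the head of each being the tail of the next; vertices and arcs may be repeated, and the empty path at each vertex (with resource $0$) is allowed. A path is elementary if it contains each vertex at most once. A cycle is a nonempty path whose origin equals its destination. The resource of $P=(a_1,\dots,a_k)$ is $x_P=x_{a_1}\oplus\cdots\oplus x_{a_k}$. $\delta^+(v)$ is the set of arcs outgoing from $v$, and $\mathcal{P}_{vd}$ is the set of $v$-$d$ paths. Definitions: $b_d^n=0$ for all $n\in\mathbb{Z}_+$; for $v\in V\setminus\{d\}$, $b_v^0=+\infty$ and $b_v^{n+1}=b_v^n\wedge\bigwedge_{(v,u)\in\delta^+(v)}(x_{(v,u)}\oplus b_u^n)$. $b_v^\infty=\bigwedge_{n\in\mathbb{Z}_+}b_v^n$.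 $b_v^{\mathrm{opt}}=\bigwedge_{P\in\mathcal{P}_{vd}}x_P$. $(b_v^\dagger)_{v\in V}$ is the greatest solution (for the product order) in $(\mathcal{R}\cup\{ -\infty,+\infty\})^V$ of the system $b_d=0$ and $b_v=b_v\wedge\bigwedge_{(v,u)\in\delta^+(v)}(x_{(v,u)}\oplus b_u)$ for all $v\in V\setminus\{d\}$. -}

module Defs where

open import Algebra.Core using (Op₂)
import Algebra.Definitions as AlgebraDefs
open import Algebra.Structures using (IsMonoid)
open import Axiom.ExcludedMiddle using (ExcludedMiddle)
open import Data.Bool.Base using (if_then_else_)
open import Data.Empty using (⊥; ⊥-elim)
open import Data.Fin.Base using (Fin)
open import Data.Fin.Properties using (_≟_)
open import Data.List.Base using (List; []; _∷_; map; foldr; filter; length; allFin)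
open import Data.List.Relation.Unary.Unique.Propositional using (Unique)
open import Data.Nat.Base as ℕ using (ℕ; zero; suc)
open import Data.Product.Base using (Σ-syntax; ∃; ∃-syntax; _×_; _,_; proj₁; proj₂)
open import Level using (Level; _⊔_; Lift; lift) renaming (suc to lsuc)
open import Relation.Binary.Core using (Rel)
open import Relation.Binary.Lattice using (Lattice; IsLattice)
import Relation.Binary.Construct.Add.Extrema.Equality as AddEquality
import Relation.Binary.Construct.Add.Extrema.NonStrict as AddNonStrict
open import Relation.Binary.PropositionalEquality.Core using (_≡_; _≢_; refl)
open import Relation.Nullary.Construct.Add.Extrema using (_±; ⊥±; ⊤±; [_])
open import Relation.Nullary.Decidable.Core
  using (yes; no; does; True; toWitness; fromWitness)
open import Relation.Unary using (Pred; _∈_; Satisfiable)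

record LatticeOrderedMonoid c ℓ₁ ℓ₂ : Set (lsuc (c ⊔ ℓ₁ ⊔ ℓ₂)) where
  infix  4 _≈_ _≤_
  infixr 6 _∨_
  infixr 7 _∧_
  infixl 8 _⊕_
  field
    Carrier   : Set c
    _≈_       : Rel Carrier ℓ₁
    _≤_       : Rel Carrier ℓ₂
    _∨_       : Op₂ Carrier
    _∧_       : Op₂ Carrier
    _⊕_       : Op₂ Carrier
    𝟘         : Carrier
    isLattice : IsLattice _≈_ _≤_ _∨_ _∧_
    isMonoid  : IsMonoid _≈_ _⊕_ 𝟘
    ⊕-monoʳ-≤ : ∀ x {y z} → y ≤ z → x ⊕ y ≤ x ⊕ z
    ⊕-monoˡ-≤ : ∀ x {y z} → y ≤ z → y ⊕ x ≤ z ⊕ x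

  lattice : Lattice c ℓ₁ ℓ₂
  lattice = record { isLattice = isLattice }

  ⊕-DistributesOver-∧ : Set (c ⊔ ℓ₁)
  ⊕-DistributesOver-∧ = _⊕_ DistributesOver _∧_
    where open AlgebraDefs _≈_

module _ {c ℓ₁ ℓ₂} (L : Lattice c ℓ₁ ℓ₂) where
  open Lattice L

  module _ {p} (S : Pred Carrier p) where

    LowerBound UpperBound : Pred Carrier (c ⊔ ℓ₂ ⊔ p)
    LowerBound m = ∀ {x} → x ∈ S → m ≤ x
    UpperBound j = ∀ {x} → x ∈ S → x ≤ j

    MeetOf JoinOf : Pred Carrier (c ⊔ ℓ₂ ⊔ p)
    MeetOf m = LowerBound m × (∀ {z} → LowerBound z → z ≤ m)
    JoinOf j = UpperBound j × (∀ {z} → UpperBound z → j ≤ z)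

  -- The universe level of the subsets is immaterial classically: under
  -- excluded middle every predicate is equivalent to one at the lowest level.
  ConditionallyComplete : Set (lsuc (c ⊔ ℓ₁ ⊔ ℓ₂))
  ConditionallyComplete =
    (S : Pred Carrier (c ⊔ ℓ₁ ⊔ ℓ₂)) → Satisfiable S →
    ∃ (LowerBound S) → ∃ (UpperBound S) → ∃ (MeetOf S) × ∃ (JoinOf S)

-- Loops and parallel arcs are permitted.
record Digraph : Set where
  field
    #V #A     : ℕ
    tail head : Fin #A → Fin #V

  V A : Set
  V = Fin #V
  A = Fin #A

  δ⁺ : V → List A
  δ⁺ v = filter (λ a → tail a ≟ v) (allFin #A)

  IsPath : V → List A → V → Set
  IsPath v []      w = v ≡ w
  IsPath v (a ∷ P) w = tail a ≡ v × IsPath (head a) P w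

  -- The vertices visited by a path with origin v, in order.
  vertices : V → List A → List V
  vertices v P = v ∷ map head P

  IsElementaryPath : V → List A → V → Set
  IsElementaryPath v P w = IsPath v P w × Unique (vertices v P)

  IsCycle : List A → Set
  IsCycle C = C ≢ [] × ∃[ v ] IsPath v C v

  IsLongestElementaryLength : V → V → ℕ → Set
  IsLongestElementaryLength v w ℓ =
    (∃[ P ] IsElementaryPath v P w × length P ≡ ℓ) ×
    (∀ P → IsElementaryPath v P w → length P ℕ.≤ ℓ)

module Completion {c ℓ₁ ℓ₂} (R : LatticeOrderedMonoid c ℓ₁ ℓ₂) where
  open LatticeOrderedMonoid R
  open AddEquality _≈_ public using (_≈±_)
  open AddNonStrict _≤_ public using (_≤±_)

  infixr 7 _∧±_
  infixl 8 _⊕±_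

  _∧±_ : Op₂ (Carrier ±)
  ⊥±    ∧± _     = ⊥±
  ⊤±    ∧± t     = t
  [ _ ] ∧± ⊥±    = ⊥±
  [ x ] ∧± [ y ] = [ x ∧ y ]
  [ x ] ∧± ⊤±    = [ x ]

  _⊕±_ : Carrier → Carrier ± → Carrier ±
  x ⊕± ⊥±    = ⊥±
  x ⊕± [ y ] = [ x ⊕ y ]
  x ⊕± ⊤±    = ⊤±

  ⋀ : List (Carrier ±) → Carrier ±
  ⋀ = foldr _∧±_ ⊤±

  -- Meets of arbitrary families are given by their universal property:
  -- deciding whether a subset is empty or bounded, hence computing its meet in
  -- the completion, is not constructive.  They exist classically, by
  -- Existence.meet below.
  IsMeet : ∀ {i} {I : Set i} → (I → Carrier ±) → Carrier ± → Set (i ⊔ c ⊔ ℓ₂)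
  IsMeet f m = (∀ i → m ≤± f i) × (∀ z → (∀ i → z ≤± f i) → z ≤± m)

module ShortestPath {c ℓ₁ ℓ₂} (R : LatticeOrderedMonoid c ℓ₁ ℓ₂) (D : Digraph)
  (d : Digraph.V D) (x : Digraph.A D → LatticeOrderedMonoid.Carrier R) where

  open LatticeOrderedMonoid R
  open Digraph D
  open Completion R

  resource : List A → Carrier
  resource P = foldr _⊕_ 𝟘 (map x P)

  relax : (V → Carrier ±) → V → Carrier ±
  relax b v = b v ∧± ⋀ (map (λ a → x a ⊕± b (head a)) (δ⁺ v))

  bⁿ : ℕ → V → Carrier ±
  bⁿ zero    v = if does (v ≟ d) then [ 𝟘 ] else ⊤±
  bⁿ (suc n) v = if does (v ≟ d) then [ 𝟘 ] else relax (bⁿ n) v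

  Is-b∞ : (V → Carrier ±) → Set (c ⊔ ℓ₂)
  Is-b∞ b = ∀ v → IsMeet (λ n → bⁿ n v) (b v)

  Is-bopt : (V → Carrier ±) → Set (c ⊔ ℓ₂)
  Is-bopt b = ∀ v → IsMeet {I = ∃[ P ] IsPath v P d} (λ (P , _) → [ resource P ]) (b v)

  IsSolution : (V → Carrier ±) → Set (c ⊔ ℓ₁)
  IsSolution b = b d ≈± [ 𝟘 ] × (∀ v → v ≢ d → b v ≈± relax b v)

  Is-b† : (V → Carrier ±) → Set (c ⊔ ℓ₁ ⊔ ℓ₂)
  Is-b† b = IsSolution b × (∀ b′ → IsSolution b′ → ∀ v → b′ v ≤± b v)

module Existence (em : ∀ {ℓ} → ExcludedMiddle ℓ)
  {c ℓ₁ ℓ₂} (R : LatticeOrderedMonoid c ℓ₁ ℓ₂)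
  (complete : ConditionallyComplete (LatticeOrderedMonoid.lattice R)) where

  open LatticeOrderedMonoid R
  open Lattice lattice using (x∧y≤x; x∧y≤y; ∧-greatest;
                              module Eq)
    renaming (refl to ≤-refl; trans to ≤-trans; antisym to ≤-antisym;
              reflexive to ≤-reflexive)
  open Completion R
  open AddNonStrict _≤_ hiding (_≤±_)
  open AddEquality _≈_ using (≈±-refl)

  private
    trans± : ∀ {s t u} → s ≤± t → t ≤± u → s ≤± u
    trans± = ≤±-trans ≤-trans

    refl± : ∀ {t} → t ≤± t
    refl± = ≤±-reflexive {_≈_ = _≈_} ≤-reflexive (≈±-refl Eq.refl)

    ⊤≰fin : ∀ {t y} → t ≡ [ y ] → ⊤± ≤± t → ⊥
    ⊤≰fin refl ()

  meet : ∀ {i} {I : Set i} (f : I → Carrier ±) → ∃ (IsMeet f)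
  meet {I = I} f with em {P = ∃[ i ] f i ≡ ⊥±}
  ... | yes (i , fi≡⊥) = ⊥± , (λ _ → ⊥±≤ _) , λ z z≤f → below z (z≤f i)
    where
    below : ∀ z → z ≤± f i → z ≤± ⊥±
    below z z≤fi rewrite fi≡⊥ = z≤fi
  ... | no noBot with em {P = ∃[ i ] ∃[ y ] f i ≡ [ y ]}
  ... | no noFin = ⊤± , (λ i → top i) , λ z _ → z ≤⊤±
    where
    top : ∀ i → ⊤± ≤± f i
    top i with f i in eq
    ... | ⊥±    = ⊥-elim (noBot (i , eq))
    ... | [ y ] = ⊥-elim (noFin (i , y , eq))
    ... | ⊤±    = ⊤±≤⊤±
  ... | yes (i₀ , y₀ , eq₀) with em {P = ∃[ w ] (∀ i → [ w ] ≤± f i)}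
  ... | no unbounded = ⊥± , (λ _ → ⊥±≤ _) , greatest
    where
    greatest : ∀ z → (∀ i → z ≤± f i) → z ≤± ⊥±
    greatest ⊥±    _   = refl±
    greatest [ w ] w≤f = ⊥-elim (unbounded (w , w≤f))
    greatest ⊤±    ⊤≤f = ⊥-elim (⊤≰fin eq₀ (⊤≤f i₀))
  ... | yes (w₀ , w₀≤f) = [ m ] , lower , greatest
    where
    Values : Pred Carrier _
    Values u = ∃[ i ] ∃[ y ] f i ≡ [ y ] × u ≡ y ∧ y₀

    S : Pred Carrier _
    S u = Lift (c ⊔ ℓ₁ ⊔ ℓ₂) (True (em {P = Values u}))

    fin≤ : ∀ {w i y} → f i ≡ [ y ] → [ w ] ≤± f i → w ≤ y
    fin≤ {i = i} eq w≤ with f i | eq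
    ... | _ | refl = [≤]-injective w≤

    lowerS : ∀ {w} → (∀ i → [ w ] ≤± f i) → LowerBound lattice S w
    lowerS w≤f (lift t) with toWitness t
    ... | i , y , eq , refl = ∧-greatest (fin≤ eq (w≤f i)) (fin≤ eq₀ (w≤f i₀))

    upperS : UpperBound lattice S y₀
    upperS (lift t) with toWitness t
    ... | i , y , eq , refl = x∧y≤y y y₀

    meetS : ∃ (MeetOf lattice S)
    meetS = proj₁ (complete S
      (y₀ ∧ y₀ , lift (fromWitness (i₀ , y₀ , eq₀ , refl)))
      (w₀ , lowerS w₀≤f) (y₀ , upperS))

    m : Carrier
    m = proj₁ meetS

    lower : ∀ i → [ m ] ≤± f i
    lower i with f i in eq
    ... | ⊥±    = ⊥-elim (noBot (i , eq))
    ... | [ y ] = [ ≤-trans (proj₁ (proj₂ meetS)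
                      (lift (fromWitness (i , y , eq , refl)))) (x∧y≤x y y₀) ]
    ... | ⊤±    = [ m ]≤⊤±

    greatest : ∀ z → (∀ i → z ≤± f i) → z ≤± [ m ]
    greatest ⊥±    _   = ⊥±≤ _
    greatest [ w ] w≤f = [ proj₂ (proj₂ meetS) (lowerS w≤f) ]
    greatest ⊤±    ⊤≤f = ⊥-elim (⊤≰fin eq₀ (⊤≤f i₀))

  private
    join : ∀ {i} {I : Set i} (f : I → Carrier ±) →
           ∃[ j ] (∀ i → f i ≤± j) × (∀ z → (∀ i → f i ≤± z) → j ≤± z)
    join f with meet {I = ∃[ u ] (∀ i → f i ≤± u)} proj₁
    ... | j , j≤ , greatest =
      j , (λ i → greatest (f i) (λ (_ , f≤u) → f≤u i)) , λ z f≤z → j≤ (z , f≤z)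

    ∧±-mono : ∀ {s t u v} → s ≤± u → t ≤± v → (s ∧± t) ≤± (u ∧± v)
    ∧±-mono {⊥±}                  _      _     = ⊥±≤ _
    ∧±-mono {⊤±}    {u = ⊤±}      _      q     = q
    ∧±-mono {[ _ ]} {⊥±}          _      _     = ⊥±≤ _
    ∧±-mono {[ a ]} {[ b ]} {[ _ ]} {[ _ ]} [ p ] [ q ] =
      [ ∧-greatest (≤-trans (x∧y≤x a b) p) (≤-trans (x∧y≤y a b) q) ]
    ∧±-mono {[ a ]} {[ b ]} {[ _ ]} {⊤±} [ p ] _ = [ ≤-trans (x∧y≤x a b) p ]
    ∧±-mono {[ a ]} {[ b ]} {⊤±} {[ _ ]} _ [ q ] = [ ≤-trans (x∧y≤y a b) q ]
    ∧±-mono {[ _ ]} {[ _ ]} {⊤±} {⊤±}    _ _     = _ ≤⊤±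
    ∧±-mono {[ _ ]} {⊤±}    {[ _ ]} {⊤±} p _     = p
    ∧±-mono {[ _ ]} {⊤±}    {⊥±}    {⊤±} p _     = p
    ∧±-mono {[ _ ]} {⊤±}    {⊤±}    {⊤±} _ _     = _ ≤⊤±

    ⊕±-mono : ∀ a {s t} → s ≤± t → (a ⊕± s) ≤± (a ⊕± t)
    ⊕±-mono a {⊥±}    {t}     _     = ⊥±≤ _
    ⊕±-mono a {[ _ ]} {[ _ ]} [ p ] = [ ⊕-monoʳ-≤ a p ]
    ⊕±-mono a {[ _ ]} {⊤±}    _     = _ ≤⊤±
    ⊕±-mono a {⊤±}    {⊤±}    _     = refl±

  module _ (D : Digraph) (d : Digraph.V D) (x : Digraph.A D → Carrier) where
    open Digraph D
    open ShortestPath R D d x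

    b∞ : ∃ Is-b∞
    b∞ = (λ v → proj₁ (meet (λ n → bⁿ n v))) , λ v → proj₂ (meet (λ n → bⁿ n v))

    bopt : ∃ Is-bopt
    bopt = (λ v → proj₁ (m v)) , λ v → proj₂ (m v)
      where m = λ v → meet {I = ∃[ P ] IsPath v P d} (λ (P , _) → [ resource P ])

    b† : ∃ Is-b†
    b† = J , (at-d , off-d) , λ b sol → J-upper (b , solution⇒post sol)
      where
      F : (V → Carrier ±) → V → Carrier ±
      F b v = if does (v ≟ d) then [ 𝟘 ] else relax b v

      F-mono : ∀ {b b′} → (∀ v → b v ≤± b′ v) → ∀ v → F b v ≤± F b′ v
      F-mono {b} {b′} b≤b′ v with v ≟ d
      ... | yes _ = refl±
      ... | no  _ = ∧±-mono (b≤b′ v) (⋀-mono (δ⁺ v))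
        where
        ⋀-mono : ∀ as → ⋀ (map (λ a → x a ⊕± b (head a)) as) ≤±
                        ⋀ (map (λ a → x a ⊕± b′ (head a)) as)
        ⋀-mono []       = refl±
        ⋀-mono (a ∷ as) = ∧±-mono (⊕±-mono (x a) (b≤b′ (head a))) (⋀-mono as)

      PostFixed : Set _
      PostFixed = Σ[ b ∈ (V → Carrier ±) ] (∀ v → b v ≤± F b v)

      solution⇒post : ∀ {b} → IsSolution b → ∀ v → b v ≤± F b v
      solution⇒post (b-d , b-off) v with v ≟ d
      ... | yes refl = ≤±-reflexive ≤-reflexive b-d
      ... | no  v≢d  = ≤±-reflexive ≤-reflexive (b-off v v≢d)

      sup : ∀ v → _
      sup v = join {I = PostFixed} (λ (b , _) → b v)

      J : V → Carrier ±
      J v = proj₁ (sup v)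

      J-upper : ((b , _) : PostFixed) → ∀ v → b v ≤± J v
      J-upper b v = proj₁ (proj₂ (sup v)) b

      J≤FJ : ∀ v → J v ≤± F J v
      J≤FJ v = proj₂ (proj₂ (sup v)) (F J v)
        (λ p → trans± (proj₂ p v) (F-mono (J-upper p) v))

      J≈FJ : ∀ v → J v ≈± F J v
      J≈FJ v = ≤±-antisym ≤-antisym (J≤FJ v) (J-upper (F J , F-mono J≤FJ) v)

      at-d : J d ≈± [ 𝟘 ]
      at-d with d ≟ d | J≈FJ d
      ... | yes _  | e = e
      ... | no d≢d | _ = ⊥-elim (d≢d refl)

      off-d : ∀ v → v ≢ d → J v ≈± relax J v
      off-d v v≢d with v ≟ d | J≈FJ v
      ... | yes v≡d | _ = ⊥-elim (v≢d v≡d)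
      ... | no _    | e = e

{-# OPTIONS --safe #-}

-- Deleting a cycle from a path does not increase its resource, so below every
-- v-d path there is an elementary one, and b_v^n is below the resource of every
-- v-d path with at most n arcs; hence b_v^ℓ* ≤ b_v^opt.  Every solution of the
-- system is below every b^n, by induction on n.  With distributivity, induction
-- on n shows that a lower bound of the resources of all v-d paths is below
-- b_v^n.  For N = |V| this applies to b_v^opt and to b_v^N itself, so b^N is a
-- solution of the system and b_v^opt ≤ b_v^N ≤ b_v^†, closing the chain.

module Submission where

open import Algebra.Structures using (IsMonoid)
open import Data.Empty using (⊥-elim)
open import Data.Fin.Base using (Fin; zero; suc)
open import Data.Fin.Properties using (_≟_; injective⇒≤)
open import Data.List.Base using (List; []; _∷_; _++_; map; length; lookup; allFin)
open import Data.List.Membership.Propositional using (_∈_)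
open import Data.List.Membership.Propositional.Properties
  using (∈-filter⁺; ∈-filter⁻; ∈-allFin; ∈-lookup)
import Data.List.Membership.DecPropositional as DecMembership
open import Data.List.Properties using (length-map)
open import Data.List.Relation.Unary.All as All using ([])
open import Data.List.Relation.Unary.All.Properties using (¬Any⇒All¬)
open import Data.List.Relation.Unary.AllPairs using ([]; _∷_)
open import Data.List.Relation.Unary.Any using (here; there)
open import Data.List.Relation.Unary.Unique.Propositional using (Unique)
open import Data.Nat.Base as ℕ using (ℕ; zero; suc; z≤n; s≤s)
import Data.Nat.Properties as ℕ
open import Data.Product.Base using (_×_; _,_; ∃-syntax; proj₁; proj₂)
open import Level using (_⊔_)
open import Relation.Binary.Bundles using (Poset)
import Relation.Binary.Construct.Add.Extrema.Equality as AddEquality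
import Relation.Binary.Construct.Add.Extrema.NonStrict as AddNonStrict
open import Relation.Binary.Lattice using (Lattice)
open import Relation.Binary.PropositionalEquality.Core
  using (_≡_; _≢_; refl; sym; cong; subst)
import Relation.Binary.Reasoning.PartialOrder as PosetReasoning
open import Relation.Nullary.Construct.Add.Extrema using (_±; ⊥±; ⊤±; [_])
open import Relation.Nullary.Decidable.Core using (yes; no)
open import Defs

-- Lists without repetition.

Unique⇒lookup-injective : ∀ {a} {A : Set a} {xs : List A} → Unique xs →
  ∀ {i j} → lookup xs i ≡ lookup xs j → i ≡ j
Unique⇒lookup-injective (x∉ ∷ u) {zero}  {zero}  eq = refl
Unique⇒lookup-injective (x∉ ∷ u) {zero}  {suc j} eq = ⊥-elim (All.lookup x∉ (∈-lookup j) eq)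
Unique⇒lookup-injective (x∉ ∷ u) {suc i} {zero}  eq = ⊥-elim (All.lookup x∉ (∈-lookup i) (sym eq))
Unique⇒lookup-injective (x∉ ∷ u) {suc i} {suc j} eq = cong suc (Unique⇒lookup-injective u eq)

-- Pigeonhole: `lookup` injects the positions of the list into `Fin n`.
Unique⇒length≤ : ∀ {n} {xs : List (Fin n)} → Unique xs → length xs ℕ.≤ n
Unique⇒length≤ u = injective⇒≤ (Unique⇒lookup-injective u)

-- Arcs and elementary paths of a digraph.

module Paths (D : Digraph) where
  open Digraph D

  ∈-δ⁺⁺ : ∀ {a v} → tail a ≡ v → a ∈ δ⁺ v
  ∈-δ⁺⁺ {v = v} = ∈-filter⁺ (λ a → tail a ≟ v) (∈-allFin _)

  ∈-δ⁺⁻ : ∀ {a v} → a ∈ δ⁺ v → tail a ≡ v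
  ∈-δ⁺⁻ {v = v} a∈ = proj₂ (∈-filter⁻ (λ a → tail a ≟ v) {xs = allFin #A} a∈)

  elementary-length : ∀ {v w} P → IsElementaryPath v P w → length P ℕ.≤ #V
  elementary-length P (_ , u) =
    -- A path visits one vertex more than it has arcs, so the pigeonhole bound is strict in
    -- `length P`.
    ℕ.<⇒≤ (subst (ℕ._< #V) (length-map head P) (Unique⇒length≤ u))

  -- Serves to delete cycles: when an arc from `u` to `v` precedes `P`, it closes `C` into a cycle,
  -- and `Q` is what remains once that cycle is removed.
  split-elementary : ∀ {u v w} P → IsElementaryPath v P w → u ∈ vertices v P →
    ∃[ C ] ∃[ Q ] P ≡ C ++ Q × IsPath v C u × IsElementaryPath u Q w
  split-elementary P       p                      (here refl) = [] , P , refl , refl , p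
  split-elementary (a ∷ P) ((refl , p) , (_ ∷ u)) (there u∈)
    with C , Q , refl , c , q ← split-elementary P (p , u) u∈
    = a ∷ C , Q , refl , (refl , c) , q

-- Order, meets and translations in the completed lattice.

module CompletionProperties {c ℓ₁ ℓ₂} (R : LatticeOrderedMonoid c ℓ₁ ℓ₂) where
  open LatticeOrderedMonoid R
  open Lattice lattice
    using (isPartialOrder; x∧y≤x; x∧y≤y; ∧-greatest)
  open IsMonoid isMonoid using (assoc; identityˡ)
  open Completion R
  open AddNonStrict _≤_ using (⊥±≤_; _≤⊤±; [_]; ≤±-isPartialOrder)
  open AddEquality _≈_ using ([_]; ⊥±≈⊥±; ⊤±≈⊤±)

  poset± : Poset c (c ⊔ ℓ₁) (c ⊔ ℓ₂)
  poset± = record { isPartialOrder = ≤±-isPartialOrder isPartialOrder }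

  open Poset poset± public using ()
    renaming (refl to ≤±-refl; trans to ≤±-trans; reflexive to ≤±-reflexive;
              antisym to ≤±-antisym; module Eq to Eq±)

  ∧±-lowerˡ : ∀ s t → s ∧± t ≤± s
  ∧±-lowerˡ ⊥±    t     = ⊥±≤ _
  ∧±-lowerˡ ⊤±    t     = t ≤⊤±
  ∧±-lowerˡ [ x ] ⊥±    = ⊥±≤ _
  ∧±-lowerˡ [ x ] [ y ] = [ x∧y≤x x y ]
  ∧±-lowerˡ [ x ] ⊤±    = ≤±-refl

  ∧±-lowerʳ : ∀ s t → s ∧± t ≤± t
  ∧±-lowerʳ ⊥±    t     = ⊥±≤ _
  ∧±-lowerʳ ⊤±    t     = ≤±-refl
  ∧±-lowerʳ [ x ] ⊥±    = ⊥±≤ _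
  ∧±-lowerʳ [ x ] [ y ] = [ x∧y≤y x y ]
  ∧±-lowerʳ [ x ] ⊤±    = [ x ] ≤⊤±

  ∧±-greatest : ∀ {z} s t → z ≤± s → z ≤± t → z ≤± s ∧± t
  ∧±-greatest ⊥±    t     p     q     = p
  ∧±-greatest ⊤±    t     p     q     = q
  ∧±-greatest [ x ] ⊥±    p     q     = q
  ∧±-greatest {⊥±}    [ x ] [ y ] p q = ⊥±≤ _
  ∧±-greatest {[ z ]} [ x ] [ y ] [ p ] [ q ] = [ ∧-greatest p q ]
  ∧±-greatest [ x ] ⊤±    p     q     = p

  ⊕±-monoʳ-≤ : ∀ x {s t} → s ≤± t → x ⊕± s ≤± x ⊕± t
  ⊕±-monoʳ-≤ x {⊥±}            _     = ⊥±≤ _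
  ⊕±-monoʳ-≤ x {[ _ ]} {[ _ ]} [ p ] = [ ⊕-monoʳ-≤ x p ]
  ⊕±-monoʳ-≤ x {t = ⊤±}        _     = _ ≤⊤±

  ⊕±-assoc : ∀ x y t → (x ⊕ y) ⊕± t ≈± x ⊕± (y ⊕± t)
  ⊕±-assoc x y ⊥±    = ⊥±≈⊥±
  ⊕±-assoc x y [ z ] = [ assoc x y z ]
  ⊕±-assoc x y ⊤±    = ⊤±≈⊤±

  ⊕±-identityˡ : ∀ t → 𝟘 ⊕± t ≈± t
  ⊕±-identityˡ ⊥±    = ⊥±≈⊥±
  ⊕±-identityˡ [ z ] = [ identityˡ z ]
  ⊕±-identityˡ ⊤±    = ⊤±≈⊤±

  ⋀-lower : ∀ {i} {I : Set i} (f : I → Carrier ±) {i is} → i ∈ is → ⋀ (map f is) ≤± f i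
  ⋀-lower f (here refl) = ∧±-lowerˡ _ _
  ⋀-lower f (there i∈)  = ≤±-trans (∧±-lowerʳ (f _) _) (⋀-lower f i∈)

  ⋀-greatest : ∀ {i} {I : Set i} (f : I → Carrier ±) is {z} →
    (∀ {i} → i ∈ is → z ≤± f i) → z ≤± ⋀ (map f is)
  ⋀-greatest f []       h = _ ≤⊤±
  ⋀-greatest f (i ∷ is) h =
    ∧±-greatest (f i) _ (h (here refl)) (⋀-greatest f is (λ i∈ → h (there i∈)))

  module _ (distrib : ⊕-DistributesOver-∧) where

    ⊕±-distribˡ-∧± : ∀ x s t → x ⊕± (s ∧± t) ≈± (x ⊕± s) ∧± (x ⊕± t)
    ⊕±-distribˡ-∧± x ⊥±    t     = ⊥±≈⊥±
    ⊕±-distribˡ-∧± x ⊤±    t     = Eq±.refl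
    ⊕±-distribˡ-∧± x [ y ] ⊥±    = ⊥±≈⊥±
    ⊕±-distribˡ-∧± x [ y ] [ z ] = [ proj₁ distrib x y z ]
    ⊕±-distribˡ-∧± x [ y ] ⊤±    = Eq±.refl

    -- Isotony alone gives `x ⊕± (s ∧± t) ≤± (x ⊕± s) ∧± (x ⊕± t)`; distributivity supplies the
    -- converse needed here.
    ⊕±-∧±-greatest : ∀ x s t {z} → z ≤± x ⊕± s → z ≤± x ⊕± t → z ≤± x ⊕± (s ∧± t)
    ⊕±-∧±-greatest x s t p q =
      ≤±-trans (∧±-greatest _ _ p q) (≤±-reflexive (Eq±.sym (⊕±-distribˡ-∧± x s t)))

    ⊕±-⋀-greatest : ∀ {i} {I : Set i} x (f : I → Carrier ±) is {z} →
      (∀ {i} → i ∈ is → z ≤± x ⊕± f i) → z ≤± x ⊕± ⋀ (map f is)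
    -- The empty meet is `⊤±`, which every translation fixes.
    ⊕±-⋀-greatest x f []       h = _ ≤⊤±
    ⊕±-⋀-greatest x f (i ∷ is) h =
      ⊕±-∧±-greatest x (f i) _ (h (here refl)) (⊕±-⋀-greatest x f is (λ i∈ → h (there i∈)))

-- Solutions of the system, the iterates `bⁿ` and resources of paths.

module ShortestPathProperties {c ℓ₁ ℓ₂} (R : LatticeOrderedMonoid c ℓ₁ ℓ₂) (D : Digraph)
  (d : Digraph.V D) (x : Digraph.A D → LatticeOrderedMonoid.Carrier R) where

  open LatticeOrderedMonoid R
  open Lattice lattice using (poset; module Eq)
    renaming (refl to ≤-refl; reflexive to ≤-reflexive)
  open IsMonoid isMonoid using (assoc; identityˡ; ∙-cong)
  open Digraph D
  open Paths D
  open DecMembership (_≟_ {#V}) using (_∈?_)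
  open Completion R
  open CompletionProperties R
  open ShortestPath R D d x
  open AddNonStrict _≤_ using (_≤⊤±; [_])

  arcs : (V → Carrier ±) → A → Carrier ±
  arcs b a = x a ⊕± b (head a)

  relax≤arc : ∀ b a → relax b (tail a) ≤± x a ⊕± b (head a)
  relax≤arc b a = ≤±-trans (∧±-lowerʳ (b _) _) (⋀-lower (arcs b) (∈-δ⁺⁺ refl))

  bⁿ-target : ∀ n → bⁿ n d ≡ [ 𝟘 ]
  bⁿ-target zero with d ≟ d
  ... | yes _  = refl
  ... | no d≢d = ⊥-elim (d≢d refl)
  bⁿ-target (suc n) with d ≟ d
  ... | yes _  = refl
  ... | no d≢d = ⊥-elim (d≢d refl)

  bⁿ-suc : ∀ n {v} → v ≢ d → bⁿ (suc n) v ≡ relax (bⁿ n) v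
  bⁿ-suc n {v} v≢d with v ≟ d
  ... | yes v≡d = ⊥-elim (v≢d v≡d)
  ... | no  _   = refl

  -- Off `d` the iteration starts at `⊤±`. A solution equals its own relaxation, hence lies below
  -- each of its arc terms, and isotony of translations carries the bound from `n` to `suc n`.
  solution≤bⁿ : ∀ {b} → IsSolution b → ∀ n v → b v ≤± bⁿ n v
  solution≤bⁿ (b-d , _) zero v with v ≟ d
  ... | yes refl = ≤±-reflexive b-d
  ... | no  _    = _ ≤⊤±
  solution≤bⁿ {b} sol@(b-d , b-off) (suc n) v with v ≟ d
  ... | yes refl = ≤±-reflexive b-d
  ... | no  v≢d  = ∧±-greatest _ _ (solution≤bⁿ sol n v) (⋀-greatest (arcs (bⁿ n)) (δ⁺ v) arc)
    where
    arc : ∀ {a} → a ∈ δ⁺ v → b v ≤± x a ⊕± bⁿ n (head a)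
    arc {a} a∈ with refl ← ∈-δ⁺⁻ a∈ = begin
      b (tail a)             ≈⟨ b-off (tail a) v≢d ⟩
      relax b (tail a)       ≤⟨ relax≤arc b a ⟩
      x a ⊕± b (head a)      ≤⟨ ⊕±-monoʳ-≤ (x a) (solution≤bⁿ sol n (head a)) ⟩
      x a ⊕± bⁿ n (head a)   ∎
      where open PosetReasoning poset±

  resource-++ : ∀ P Q → resource (P ++ Q) ≈ resource P ⊕ resource Q
  resource-++ []      Q = Eq.sym (identityˡ _)
  resource-++ (a ∷ P) Q = Eq.trans (∙-cong Eq.refl (resource-++ P Q)) (Eq.sym (assoc _ _ _))

  module _ (nonneg : ∀ C → IsCycle C → 𝟘 ≤ resource C) where

    -- The empty path is not a cycle, but its resource is `𝟘`.
    closed-nonneg : ∀ {v} P → IsPath v P v → 𝟘 ≤ resource P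
    closed-nonneg []      _ = ≤-refl
    closed-nonneg (a ∷ P) p = nonneg (a ∷ P) ((λ ()) , _ , p)

    bⁿ≤resource : ∀ n {v} P → IsPath v P d → length P ℕ.≤ n → bⁿ n v ≤± [ resource P ]
    bⁿ≤resource n {v} P p len with v ≟ d
    -- The value at `d` is held at `𝟘`, and a path from `d` to `d` is closed, so the cycle condition
    -- applies.
    ... | yes refl rewrite bⁿ-target n = [ closed-nonneg P p ]
    bⁿ≤resource n       []      v≡d        len       | no v≢d = ⊥-elim (v≢d v≡d)
    bⁿ≤resource (suc n) (a ∷ P) (refl , p) (s≤s len) | no v≢d rewrite bⁿ-suc n v≢d =
      ≤±-trans (relax≤arc (bⁿ n) a) (⊕±-monoʳ-≤ (x a) (bⁿ≤resource n P p len))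

    -- By induction the path after the first arc can be made elementary. If it meets `v` again, the
    -- first arc and the portion up to `v` form a cycle; dropping it leaves an elementary path from
    -- `v`.
    elementary-below : ∀ {v w} P → IsPath v P w →
      ∃[ Q ] IsElementaryPath v Q w × resource Q ≤ resource P
    elementary-below []      p = [] , (p , [] ∷ []) , ≤-refl
    elementary-below {v} (a ∷ P) (tl , p)
      with Q , (q , u) , Q≤P ← elementary-below P p
      with v ∈? vertices (head a) Q
    ... | no v∉ = a ∷ Q , ((tl , q) , ¬Any⇒All¬ _ v∉ ∷ u) , ⊕-monoʳ-≤ (x a) Q≤P
    ... | yes v∈ with C , Q′ , refl , c , e ← split-elementary Q (q , u) v∈ =
      Q′ , e , (begin
        resource Q′                     ≈⟨ identityˡ _ ⟨
        𝟘 ⊕ resource Q′                 ≤⟨ ⊕-monoˡ-≤ _ (closed-nonneg (a ∷ C) (tl , c)) ⟩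
        resource (a ∷ C) ⊕ resource Q′  ≈⟨ resource-++ (a ∷ C) Q′ ⟨
        resource (a ∷ C ++ Q′)          ≤⟨ ⊕-monoʳ-≤ (x a) Q≤P ⟩
        resource (a ∷ P)                ∎)
      where open PosetReasoning poset

    -- Only elementary paths need to be short: this makes both `ℓ*` and `#V` admissible values of
    -- `n`, for paths `P` of any length.
    bⁿ≤path : ∀ n {v} → (∀ Q → IsElementaryPath v Q d → length Q ℕ.≤ n) →
      ∀ P → IsPath v P d → bⁿ n v ≤± [ resource P ]
    bⁿ≤path n short P p with Q , e , Q≤P ← elementary-below P p =
      ≤±-trans (bⁿ≤resource n Q (proj₁ e) (short Q e)) [ Q≤P ]

    module _ (distrib : ⊕-DistributesOver-∧) where

      -- The induction on n moves the first arc of the paths into the prefix r.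
      bⁿ-greatest-prefix : ∀ n r v {z} → (∀ P → IsPath v P d → z ≤± [ r ⊕ resource P ]) →
        z ≤± r ⊕± bⁿ n v
      bⁿ-greatest-prefix zero r v h with v ≟ d
      -- The empty path has resource `𝟘`, which is the value of every iterate at `d`.
      ... | yes refl = h [] refl
      ... | no  _    = _ ≤⊤±
      bⁿ-greatest-prefix (suc n) r v {z} h with v ≟ d
      ... | yes refl = h [] refl
      ... | no  _    = ⊕±-∧±-greatest distrib r (bⁿ n v) _ (bⁿ-greatest-prefix n r v h)
                         (⊕±-⋀-greatest distrib r (arcs (bⁿ n)) (δ⁺ v) arc)
        where
        arc : ∀ {a} → a ∈ δ⁺ v → z ≤± r ⊕± (x a ⊕± bⁿ n (head a))
        arc {a} a∈ = ≤±-trans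
          (bⁿ-greatest-prefix n (r ⊕ x a) (head a) λ P p →
            ≤±-trans (h (a ∷ P) (∈-δ⁺⁻ a∈ , p)) [ ≤-reflexive (Eq.sym (assoc _ _ _)) ])
          (≤±-reflexive (⊕±-assoc r (x a) (bⁿ n (head a))))

      bⁿ-greatest : ∀ n v {z} → (∀ P → IsPath v P d → z ≤± [ resource P ]) → z ≤± bⁿ n v
      bⁿ-greatest n v h = ≤±-trans
        (bⁿ-greatest-prefix n 𝟘 v λ P p → ≤±-trans (h P p) [ ≤-reflexive (Eq.sym (identityˡ _)) ])
        (≤±-reflexive (⊕±-identityˡ _))

      -- The iteration is stationary from `#V` on: `bⁿ #V v` bounds all path resources from below,
      -- so it is below the next iterate, while relaxing never increases a value. The index `#V`
      -- serves all vertices at once, whereas `ℓ*` depends on `v`.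
      b^#V-isSolution : IsSolution (bⁿ #V)
      b^#V-isSolution = Eq±.reflexive (bⁿ-target #V) , λ v v≢d →
        ≤±-antisym
          (subst (bⁿ #V v ≤±_) (bⁿ-suc #V v≢d)
            (bⁿ-greatest (suc #V) v (bⁿ≤path #V elementary-length)))
          (∧±-lowerˡ _ _)

theorem9 :
    ∀ {c ℓ₁ ℓ₂} (R : LatticeOrderedMonoid c ℓ₁ ℓ₂) (D : Digraph) →
    let open LatticeOrderedMonoid R
        open Digraph D
        open Completion R
    in
    ConditionallyComplete lattice →
    (d : V) (x : A → Carrier) →
    let open ShortestPath R D d x in
    (b† b∞ bopt : V → Carrier ±) → Is-b† b† → Is-b∞ b∞ → Is-bopt bopt →
    (∀ C → IsCycle C → 𝟘 ≤ resource C) →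
    (v : V) (P : List A) → IsPath v P d →
    (ℓ* : ℕ) → IsLongestElementaryLength v d ℓ* →
    (b† v ≤± b∞ v × b∞ v ≤± bⁿ ℓ* v × bⁿ ℓ* v ≤± bopt v × bopt v ≤± [ resource P ]) ×
    (⊕-DistributesOver-∧ →
      b† v ≈± b∞ v × b∞ v ≈± bⁿ ℓ* v × bⁿ ℓ* v ≈± bopt v)
theorem9 R D _ d x b† b∞ bopt (b†-sol , b†-greatest) b∞-meet bopt-meet nonneg v P p ℓ* (_ , longest) =
  (†≤∞ , ∞≤ℓ* , ℓ*≤opt , proj₁ (bopt-meet v) (P , p)) ,
  λ distrib →
    let opt≤† : bopt v ≤± b† v
        opt≤† = ≤±-trans (bⁿ-greatest nonneg distrib #V v (λ Q q → proj₁ (bopt-meet v) (Q , q)))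
                         (b†-greatest (bⁿ #V) (b^#V-isSolution nonneg distrib) v)
    -- With `opt≤†` the chain closes into a loop, so each inequality is reversed by following the
    -- rest of the loop.
    in ≤±-antisym †≤∞ (≤±-trans ∞≤ℓ* (≤±-trans ℓ*≤opt opt≤†)) ,
       ≤±-antisym ∞≤ℓ* (≤±-trans ℓ*≤opt (≤±-trans opt≤† †≤∞)) ,
       ≤±-antisym ℓ*≤opt (≤±-trans opt≤† (≤±-trans †≤∞ ∞≤ℓ*))
  where
  open Digraph D
  open Completion R
  open CompletionProperties R
  open ShortestPath R D d x
  open ShortestPathProperties R D d x

  †≤∞ : b† v ≤± b∞ v
  †≤∞ = proj₂ (b∞-meet v) (b† v) (λ n → solution≤bⁿ b†-sol n v)

  ∞≤ℓ* : b∞ v ≤± bⁿ ℓ* v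
  ∞≤ℓ* = proj₁ (b∞-meet v) ℓ*

  ℓ*≤opt : bⁿ ℓ* v ≤± bopt v
  ℓ*≤opt = proj₂ (bopt-meet v) (bⁿ ℓ* v) (λ (Q , q) → bⁿ≤path nonneg ℓ* longest Q q)
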